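{- For every $n\ge0$, the pairs $(\mathrm{pix},\mathrm{inv})$ and $(\mathrm{pix},\mathrm{imaj})$ are equidistributed over $\mathfrak S_n$: for all integers $a,k$, $\#\{\sigma\in\mathfrak S_n:\mathrm{pix}\,\sigma=a,\ \mathrm{inv}\,\sigma=k\}=\#\{\sigma\in\mathfrak S_n:\mathrm{pix}\,\sigma=a,\ \mathrm{imaj}\,\sigma=k\}$.
   Context: Permutations are words $\sigma(1)\cdots\sigma(n)$. $\mathrm{imaj}\,\sigma=\sum_{i\in\mathrm{DES}\,\sigma^{ -1}}i$ where $\mathrm{DES}\,\pi=\{i:\pi(i)>\pi(i+1)\}$; $\mathrm{inv}\,\sigma=\#\{(i,j):i<j,\ \sigma(i)>\sigma(j)\}$. A word $y_1\cdots y_m$ with distinct letters is a desarrangement if $y_1>\dots>y_{2k}<y_{2k+1}$ for some $k\ge1$ (convention $y_{m+1}=\infty$). Each $\sigma$ factors uniquely as $\sigma^p\sigma^d$ with $\sigma^p$ increasing and $\sigma^d$ the longest right factor of $\sigma$ that is a desarrangement (empty if $\sigma$ is increasing); $\mathrm{pix}\,\sigma$ is the length of $\sigma^p$. -}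

module Defs where

open import Data.Nat using (ℕ; zero; suc; _+_; _∸_; _<ᵇ_; _≡ᵇ_)
open import Data.Bool using (Bool; true; false; _∧_; _∨_; not; if_then_else_)
open import Data.Nat.ListAction using (sum)
open import Data.List using (List; []; _∷_; length; map; concatMap; filter; upTo; applyUpTo; tails)
open import Data.List.Relation.Unary.Unique.DecPropositional using (unique?)
open import Data.Nat.Properties using (_≟_)
open import Relation.Nullary.Decidable using (does)

oneTo : ℕ → List ℕ
oneTo n = applyUpTo suc n

words : ℕ → ℕ → List (List ℕ)
words n zero    = [] ∷ []
words n (suc m) = concatMap (λ x → map (x ∷_) (words n m)) (oneTo n)

-- the symmetric group S_n, as the list of all permutations σ(1)⋯σ(n) of {1,...,n}
-- (words of length n over {1..n} with pairwise distinct letters)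
perms : ℕ → List (List ℕ)
perms n = filter (λ w → unique? _≟_ w) (words n n)

count : {A : Set} → (A → Bool) → List A → ℕ
count p []       = 0
count p (x ∷ xs) = (if p x then 1 else 0) + count p xs

inv : List ℕ → ℕ
inv []       = 0
inv (x ∷ xs) = count (λ y → y <ᵇ x) xs + inv xs

-- DES π = {i : π(i) > π(i+1)}, positions 1-based, listed increasingly
desFrom : ℕ → List ℕ → List ℕ
desFrom i []           = []
desFrom i (x ∷ [])     = []
desFrom i (x ∷ y ∷ ys) = if y <ᵇ x then i ∷ desFrom (suc i) (y ∷ ys) else desFrom (suc i) (y ∷ ys)

DES : List ℕ → List ℕ
DES w = desFrom 1 w

posOf : ℕ → List ℕ → ℕ
posOf j []       = 0
posOf j (x ∷ xs) = if j ≡ᵇ x then 1 else suc (posOf j xs)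

inverse : List ℕ → List ℕ
inverse w = map (λ j → posOf j w) (oneTo (length w))

imaj : List ℕ → ℕ
imaj σ = sum (DES (inverse σ))

-- 1-based position of the first ascent y_i < y_{i+1}, with the convention y_{m+1} = ∞
-- (so the last position always counts as an ascent); 0 for the empty word
firstAscent : List ℕ → ℕ
firstAscent []           = 0
firstAscent (x ∷ [])     = 1
firstAscent (x ∷ y ∷ ys) = if x <ᵇ y then 1 else suc (firstAscent (y ∷ ys))

even : ℕ → Bool
even zero          = true
even (suc zero)    = false
even (suc (suc n)) = even n

-- y_1 > ⋯ > y_{2k} < y_{2k+1} for some k ≥ 1 (y_{m+1} = ∞):
-- the first ascent occurs at an even position 2k ≥ 2
isDesarrangement : List ℕ → Bool
isDesarrangement w = even (firstAscent w) ∧ (1 <ᵇ firstAscent w)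

longestDesSuffix : List ℕ → ℕ
longestDesSuffix []       = 0
longestDesSuffix (x ∷ xs) = if isDesarrangement (x ∷ xs) then length (x ∷ xs) else longestDesSuffix xs

-- pix σ = length of σᵖ, where σ = σᵖ σᵈ and σᵈ is the longest desarrangement right factor
pix : List ℕ → ℕ
pix σ = length σ ∸ longestDesSuffix σ

-- Substituting σ = π⁻¹ and using inv π⁻¹ = inv π and imaj σ = maj σ⁻¹, the claim is that
-- (pix π⁻¹, inv π) and (pix π⁻¹, maj π) are equidistributed over 𝔖ₙ. Foata's second fundamental
-- transformation, built letter by letter from the block rotations γₓ, is a bijection of 𝔖ₙ with
-- inv (foata π) = maj π. A step γₓ only moves letters past letters on the other side of x, while
-- i and i + 1 (both ≠ x) lie on the same side; so the relative order of i and i + 1 is preserved.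
-- These relative orders are the ascents of π⁻¹, and pix depends only on the ascents.

module Submission where

open import Defs
open import Data.Bool using (Bool; true; false; T; _∧_; not; if_then_else_)
open import Data.Bool.Properties using (∧-zeroʳ; ∧-identityʳ; not-injective)
open import Data.Empty using (⊥-elim)
open import Data.List using (List; []; _∷_; [_]; _++_; length; map; concatMap; applyUpTo; foldl)
open import Data.List.Properties
  using (length-applyUpTo; length-map; map-applyUpTo; ∷-injectiveʳ; ∷-injectiveˡ; ++-assoc; ++-identityʳ; ∷ʳ-injective)
open import Data.List.Membership.Propositional using (_∈_; _∉_; find; lose)
open import Data.List.Membership.Propositional.Properties
  using (∈-∃++; ∈-++⁻; ∈-map⁺; ∈-map⁻; ∈-concatMap⁺; ∈-concatMap⁻; ∈-filter⁺; ∈-filter⁻; ∈-applyUpTo⁺; ∈-applyUpTo⁻)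
open import Data.List.Relation.Binary.Permutation.Propositional using (_↭_; ↭-sym; ↭-trans; ↭⇒↭ₛ)
  renaming (refl to ↭-refl; prep to ↭-prep)
open import Data.List.Relation.Binary.Permutation.Propositional.Properties
  using (∈-resp-↭; map⁺; shift; ++⁺ˡ; ++⁺ʳ; ↭-length; ∷↭∷ʳ)
import Data.List.Relation.Binary.Permutation.Setoid.Properties as ↭ₛ
open import Data.List.Relation.Binary.Subset.Propositional using (_⊆_)
open import Data.List.Relation.Unary.All using (All; []; _∷_)
import Data.List.Relation.Unary.All as All
open import Data.List.Relation.Unary.All.Properties using (All¬⇒¬Any)
import Data.List.Relation.Unary.All.Properties as Allₚ
open import Data.List.Relation.Unary.AllPairs using (AllPairs; []; _∷_)
open import Data.List.Relation.Unary.AllPairs.Properties using (applyUpTo⁺₁)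
open import Data.List.Relation.Unary.Any using (here; there)
open import Data.List.Relation.Unary.Unique.DecPropositional using (unique?)
open import Data.List.Relation.Unary.Unique.Propositional using (Unique)
import Data.List.Relation.Unary.Unique.Propositional.Properties as Unique
open import Data.Nat using (ℕ; zero; suc; _+_; _∸_; _≤_; _<_; _<ᵇ_; _≡ᵇ_; z≤n; s≤s)
open import Data.Nat.ListAction using (sum)
open import Data.Nat.ListAction.Properties using (sum-↭)
open import Data.Nat.Properties
open import Algebra.Properties.CommutativeSemigroup +-commutativeSemigroup using (interchange)
open import Data.Nat.Tactic.RingSolver using (solve-∀)
open import Data.Product using (∃₂; _×_; _,_; proj₂)
open import Data.Sum using (inj₁; inj₂)
open import Data.Unit using (tt)
open import Function using (_∘_)
open import Relation.Binary.Definitions using (tri<; tri≈; tri>)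
open import Relation.Binary.PropositionalEquality hiding ([_])
open import Relation.Nullary using (¬_; yes; no)
open import Relation.Nullary.Decidable using (dec-true; dec-false)

≡ᵇ-refl : ∀ n → (n ≡ᵇ n) ≡ true
≡ᵇ-refl n = dec-true (n ≟ n) refl

≢⇒≡ᵇ-false : ∀ {m n} → m ≢ n → (m ≡ᵇ n) ≡ false
≢⇒≡ᵇ-false {m} {n} = dec-false (m ≟ n)

<⇒<ᵇ-true : ∀ {m n} → m < n → (m <ᵇ n) ≡ true
<⇒<ᵇ-true {m} {n} = dec-true (m <? n)

≤⇒<ᵇ-false : ∀ {m n} → n ≤ m → (m <ᵇ n) ≡ false
≤⇒<ᵇ-false {m} {n} n≤m = dec-false (m <? n) (≤⇒≯ n≤m)

<ᵇ-true⇒< : ∀ {m n} → (m <ᵇ n) ≡ true → m < n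
<ᵇ-true⇒< {m} {n} e = <ᵇ⇒< m n (subst T (sym e) tt)

<ᵇ-false⇒≥ : ∀ {m n} → (m <ᵇ n) ≡ false → n ≤ m
<ᵇ-false⇒≥ e = ≮⇒≥ (λ m<n → subst T e (<⇒<ᵇ m<n))

indicator : Bool → ℕ
indicator b = if b then 1 else 0

sumBy : {A : Set} → (A → ℕ) → List A → ℕ
sumBy f xs = sum (map f xs)

sumBy-cong : ∀ {A : Set} {f g : A → ℕ} xs → (∀ {x} → x ∈ xs → f x ≡ g x) → sumBy f xs ≡ sumBy g xs
sumBy-cong []       f≗g = refl
sumBy-cong (x ∷ xs) f≗g = cong₂ _+_ (f≗g (here refl)) (sumBy-cong xs (f≗g ∘ there))

sumBy-zero : ∀ {A : Set} (xs : List A) → sumBy (λ _ → 0) xs ≡ 0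
sumBy-zero []       = refl
sumBy-zero (x ∷ xs) = sumBy-zero xs

sumBy-+ : ∀ {A : Set} (f g : A → ℕ) xs → sumBy (λ x → f x + g x) xs ≡ sumBy f xs + sumBy g xs
sumBy-+ f g []       = refl
sumBy-+ f g (x ∷ xs) = trans (cong (f x + g x +_) (sumBy-+ f g xs)) (interchange (f x) (g x) _ _)

sumBy-↭ : ∀ {A : Set} (f : A → ℕ) {xs ys} → xs ↭ ys → sumBy f xs ≡ sumBy f ys
sumBy-↭ f p = sum-↭ (map⁺ f p)

sumBy-comm : ∀ {A B : Set} (F : A → B → ℕ) xs ys →
  sumBy (λ x → sumBy (F x) ys) xs ≡ sumBy (λ y → sumBy (λ x → F x y) xs) ys
sumBy-comm F []       ys = sym (sumBy-zero ys)
sumBy-comm F (x ∷ xs) ys =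
  trans (cong (sumBy (F x) ys +_) (sumBy-comm F xs ys)) (sym (sumBy-+ (F x) _ ys))

count≡sumBy : ∀ {A : Set} (p : A → Bool) xs → count p xs ≡ sumBy (indicator ∘ p) xs
count≡sumBy p []       = refl
count≡sumBy p (x ∷ xs) = cong (indicator (p x) +_) (count≡sumBy p xs)

module _ {A : Set} (p : A → Bool) where

  count-++ : ∀ xs ys → count p (xs ++ ys) ≡ count p xs + count p ys
  count-++ []       ys = refl
  count-++ (x ∷ xs) ys = trans (cong (indicator (p x) +_) (count-++ xs ys)) (sym (+-assoc (indicator (p x)) _ _))

  count-↭ : ∀ {xs ys} → xs ↭ ys → count p xs ≡ count p ys
  count-↭ {xs} {ys} xs↭ys =
    trans (count≡sumBy p xs) (trans (sumBy-↭ (indicator ∘ p) xs↭ys) (sym (count≡sumBy p ys)))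

  count-map : ∀ {B : Set} (f : B → A) xs → count p (map f xs) ≡ count (p ∘ f) xs
  count-map f []       = refl
  count-map f (x ∷ xs) = cong (indicator (p (f x)) +_) (count-map f xs)

  count-cong : ∀ {q : A → Bool} xs → (∀ {x} → x ∈ xs → p x ≡ q x) → count p xs ≡ count q xs
  count-cong []       p≗q = refl
  count-cong (x ∷ xs) p≗q = cong₂ (λ b n → indicator b + n) (p≗q (here refl)) (count-cong xs (p≗q ∘ there))

  count-all-true : ∀ {xs} → All (λ x → p x ≡ true) xs → count p xs ≡ length xs
  count-all-true []          = refl
  count-all-true (px ∷ pxs) rewrite px = cong suc (count-all-true pxs)

  count-all-false : ∀ {xs} → All (λ x → p x ≡ false) xs → count p xs ≡ 0
  count-all-false []          = refl
  count-all-false (px ∷ pxs) rewrite px = count-all-false pxs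

  count-+-count-not : ∀ xs → count p xs + count (not ∘ p) xs ≡ length xs
  count-+-count-not []       = refl
  count-+-count-not (x ∷ xs) with p x
  ... | true  = cong suc (count-+-count-not xs)
  ... | false = trans (+-suc (count p xs) _) (cong suc (count-+-count-not xs))

Unique-resp-↭ : ∀ {A : Set} {xs ys : List A} → xs ↭ ys → Unique xs → Unique ys
Unique-resp-↭ {A} p = ↭ₛ.Unique-resp-↭ (setoid A) (↭⇒↭ₛ p)

Unique-++⁻ˡ : ∀ {A : Set} (xs : List A) {ys} → Unique (xs ++ ys) → Unique xs
Unique-++⁻ˡ []       _            = []
Unique-++⁻ˡ (x ∷ xs) (x∉ ∷ xs++ys!) = Allₚ.++⁻ˡ xs x∉ ∷ Unique-++⁻ˡ xs xs++ys!

unique-⊆⇒↭ : ∀ {A : Set} {xs ys : List A} → Unique xs → Unique ys → xs ⊆ ys → length ys ≤ length xs → xs ↭ ys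
unique-⊆⇒↭ {xs = []}     {[]}    _ _ _ _ = ↭-refl
unique-⊆⇒↭ {xs = []}     {_ ∷ _} _ _ _ ()
unique-⊆⇒↭ {xs = x ∷ xs} {ys} (x∉xs ∷ xs!) ys! xs⊆ys ys≤xs with ∈-∃++ (xs⊆ys (here refl))
... | us , vs , refl = ↭-trans (↭-prep x (unique-⊆⇒↭ xs! us++vs! xs⊆us++vs ≤-len)) (↭-sym (shift x us vs))
  where
  us++vs! : Unique (us ++ vs)
  us++vs! with Unique-resp-↭ (shift x us vs) ys!
  ... | _ ∷ u = u
  xs⊆us++vs : xs ⊆ us ++ vs
  xs⊆us++vs z∈xs with ∈-resp-↭ (shift x us vs) (xs⊆ys (there z∈xs))
  ... | here refl = ⊥-elim (All¬⇒¬Any x∉xs z∈xs)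
  ... | there z∈  = z∈
  ≤-len : length (us ++ vs) ≤ length xs
  ≤-len = ≤-pred (subst (_≤ suc (length xs)) (↭-length (shift x us vs)) ys≤xs)

Unique-map⁺ : ∀ {A B : Set} (f : A → B) {xs : List A} →
  (∀ {a b} → a ∈ xs → b ∈ xs → f a ≡ f b → a ≡ b) → Unique xs → Unique (map f xs)
Unique-map⁺ f {[]}     inj []           = []
Unique-map⁺ f {x ∷ xs} inj (x∉xs ∷ xs!) =
  fx∉ x∉xs (λ z → z) ∷ Unique-map⁺ f (λ a b → inj (there a) (there b)) xs!
  where
  fx∉ : ∀ {ys} → All (x ≢_) ys → ys ⊆ xs → All (f x ≢_) (map f ys)
  fx∉ []             _    = []
  fx∉ (x≢y ∷ x∉ys) ys⊆ = (x≢y ∘ inj (here refl) (there (ys⊆ (here refl)))) ∷ fx∉ x∉ys (ys⊆ ∘ there)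

∈-oneTo⁺ : ∀ {n j} → 1 ≤ j → j ≤ n → j ∈ oneTo n
∈-oneTo⁺ {n} {suc i} _ i<n = ∈-applyUpTo⁺ suc i<n

length-oneTo : ∀ n → length (oneTo n) ≡ n
length-oneTo = length-applyUpTo suc

oneTo-increasing : ∀ n → AllPairs _<_ (oneTo n)
oneTo-increasing n = applyUpTo⁺₁ suc n (λ i<j _ → s≤s i<j)

Unique-oneTo : ∀ n → Unique (oneTo n)
Unique-oneTo n = applyUpTo⁺₁ suc n (λ i<j _ → <⇒≢ i<j ∘ suc-injective)

∈-words⁺ : ∀ n m {w} → length w ≡ m → w ⊆ oneTo n → w ∈ words n m
∈-words⁺ n zero    {[]}    _ _ = here refl
∈-words⁺ n (suc m) {x ∷ w} ∣w∣≡ w⊆ =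
  ∈-concatMap⁺ (λ x → map (x ∷_) (words n m))
    (lose (w⊆ (here refl)) (∈-map⁺ (x ∷_) (∈-words⁺ n m (suc-injective ∣w∣≡) (w⊆ ∘ there))))

∈-words⁻ : ∀ n m {w} → w ∈ words n m → length w ≡ m × w ⊆ oneTo n
∈-words⁻ n zero    (here refl) = refl , λ ()
∈-words⁻ n (suc m) w∈ with find (∈-concatMap⁻ (λ x → map (x ∷_) (words n m)) {xs = oneTo n} w∈)
... | x , x∈ , w∈′ with ∈-map⁻ (x ∷_) w∈′
... | w , w∈″ , refl with ∈-words⁻ n m w∈″
... | ∣w∣≡ , w⊆ = cong suc ∣w∣≡ , λ { (here refl) → x∈ ; (there z∈) → w⊆ z∈ }

Unique-words : ∀ n m → Unique (words n m)
Unique-words n zero    = [] ∷ []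
Unique-words n (suc m) = prefixed (oneTo n) (Unique-oneTo n)
  where
  W : List (List ℕ)
  W = words n m
  prefixed : ∀ xs → Unique xs → Unique (concatMap (λ x → map (x ∷_) W) xs)
  prefixed []       []           = []
  prefixed (x ∷ xs) (x∉xs ∷ xs!) =
    Unique.++⁺ (Unique.map⁺ ∷-injectiveʳ (Unique-words n m)) (prefixed xs xs!) disjoint
    where
    disjoint : ∀ {v} → ¬ (v ∈ map (x ∷_) W × v ∈ concatMap (λ x → map (x ∷_) W) xs)
    disjoint (v∈ , v∈′) with ∈-map⁻ (x ∷_) v∈ | find (∈-concatMap⁻ (λ x → map (x ∷_) W) {xs = xs} v∈′)
    ... | _ , _ , refl | y , y∈ , v∈″ with ∈-map⁻ (y ∷_) v∈″
    ... | _ , _ , e = All¬⇒¬Any x∉xs (subst (_∈ xs) (sym (∷-injectiveˡ e)) y∈)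

IsPermutation : ℕ → List ℕ → Set
IsPermutation n w = w ↭ oneTo n

IsPermutation⇒Unique : ∀ {n w} → IsPermutation n w → Unique w
IsPermutation⇒Unique {n} σ = Unique-resp-↭ (↭-sym σ) (Unique-oneTo n)

IsPermutation⇒length : ∀ {n w} → IsPermutation n w → length w ≡ n
IsPermutation⇒length {n} σ = trans (↭-length σ) (length-oneTo n)

∈-perms⁺ : ∀ {n w} → IsPermutation n w → w ∈ perms n
∈-perms⁺ {n} σ = ∈-filter⁺ (unique? _≟_) (∈-words⁺ n n (IsPermutation⇒length σ) (∈-resp-↭ σ)) (IsPermutation⇒Unique σ)

∈-perms⁻ : ∀ {n w} → w ∈ perms n → IsPermutation n w
∈-perms⁻ {n} w∈ with ∈-filter⁻ (unique? _≟_) {xs = words n n} w∈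
... | w∈′ , w! with ∈-words⁻ n n w∈′
... | ∣w∣≡n , w⊆ = unique-⊆⇒↭ w! (Unique-oneTo n) w⊆ (≤-reflexive (trans (length-oneTo n) (sym ∣w∣≡n)))

Unique-perms : ∀ n → Unique (perms n)
Unique-perms n = Unique.filter⁺ (unique? _≟_) (Unique-words n n)

module _ (n : ℕ) (p : List ℕ → Bool) where

  count-perms-cong : ∀ {q} → (∀ {σ} → IsPermutation n σ → p σ ≡ q σ) → count p (perms n) ≡ count q (perms n)
  count-perms-cong p≗q = count-cong p (perms n) (p≗q ∘ ∈-perms⁻)

  count-perms-reindex : (f : List ℕ → List ℕ) →
    (∀ {σ} → IsPermutation n σ → IsPermutation n (f σ)) →
    (∀ {σ τ} → IsPermutation n σ → IsPermutation n τ → f σ ≡ f τ → σ ≡ τ) →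
    count (p ∘ f) (perms n) ≡ count p (perms n)
  count-perms-reindex f f-perm f-inj = trans (sym (count-map p f (perms n))) (count-↭ p f[Sₙ]↭Sₙ)
    where
    f[Sₙ]↭Sₙ : map f (perms n) ↭ perms n
    f[Sₙ]↭Sₙ = unique-⊆⇒↭
      (Unique-map⁺ f (λ σ∈ τ∈ → f-inj (∈-perms⁻ σ∈) (∈-perms⁻ τ∈)) (Unique-perms n))
      (Unique-perms n)
      (λ v∈ → let σ , σ∈ , v≡ = ∈-map⁻ f v∈ in subst (_∈ perms n) (sym v≡) (∈-perms⁺ (f-perm (∈-perms⁻ σ∈))))
      (≤-reflexive (sym (length-map f (perms n))))

∈-∷⁻ : ∀ {A : Set} {x y : A} {ys} → x ∈ y ∷ ys → x ≢ y → x ∈ ys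
∈-∷⁻ (here x≡y)  x≢y = ⊥-elim (x≢y x≡y)
∈-∷⁻ (there x∈) _   = x∈

∉-∷⁺ : ∀ {A : Set} {x y : A} {ys} → x ≢ y → x ∉ ys → x ∉ y ∷ ys
∉-∷⁺ x≢y x∉ys (here x≡y) = x≢y x≡y
∉-∷⁺ x≢y x∉ys (there x∈) = x∉ys x∈

posOf-here : ∀ y ys → posOf y (y ∷ ys) ≡ 1
posOf-here y ys rewrite ≡ᵇ-refl y = refl

posOf-there : ∀ {j y} ys → j ≢ y → posOf j (y ∷ ys) ≡ suc (posOf j ys)
posOf-there ys j≢y rewrite ≢⇒≡ᵇ-false j≢y = refl

posOf-positive : ∀ {j} w → j ∈ w → 0 < posOf j w
posOf-positive {j} (y ∷ ys) _ with j ≡ᵇ y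
... | true  = s≤s z≤n
... | false = s≤s z≤n

posOf-≤-length : ∀ {j} w → j ∈ w → posOf j w ≤ length w
posOf-≤-length {j} (y ∷ ys) j∈ with j ≟ y
... | yes refl rewrite posOf-here j ys = s≤s z≤n
... | no j≢y   rewrite posOf-there ys j≢y = s≤s (posOf-≤-length ys (∈-∷⁻ j∈ j≢y))

posOf-injective : ∀ {i j} w → i ∈ w → j ∈ w → posOf i w ≡ posOf j w → i ≡ j
posOf-injective {i} {j} (y ∷ ys) i∈ j∈ pos≡ with i ≟ y | j ≟ y
... | yes refl | yes refl = refl
... | yes refl | no j≢y rewrite posOf-here y ys | posOf-there ys j≢y =
  ⊥-elim (<⇒≢ (s≤s (posOf-positive ys (∈-∷⁻ j∈ j≢y))) pos≡)
... | no i≢y | yes refl rewrite posOf-here y ys | posOf-there ys i≢y =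
  ⊥-elim (<⇒≢ (s≤s (posOf-positive ys (∈-∷⁻ i∈ i≢y))) (sym pos≡))
... | no i≢y | no j≢y rewrite posOf-there ys i≢y | posOf-there ys j≢y =
  posOf-injective ys (∈-∷⁻ i∈ i≢y) (∈-∷⁻ j∈ j≢y) (suc-injective pos≡)

-- i occurs before any occurrence of j (so an absent j counts as coming last).
precedes : ℕ → ℕ → List ℕ → Bool
precedes i j []       = false
precedes i j (y ∷ ys) = if i ≡ᵇ y then not (j ≡ᵇ y) else (if j ≡ᵇ y then false else precedes i j ys)

precedes-head : ∀ {y j} ys → j ≢ y → precedes y j (y ∷ ys) ≡ true
precedes-head {y} ys j≢y rewrite ≡ᵇ-refl y | ≢⇒≡ᵇ-false j≢y = refl

precedes-head′ : ∀ {y i} ys → i ≢ y → precedes i y (y ∷ ys) ≡ false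
precedes-head′ {y} ys i≢y rewrite ≡ᵇ-refl y | ≢⇒≡ᵇ-false i≢y = refl

precedes-tail : ∀ {y i j} ys → i ≢ y → j ≢ y → precedes i j (y ∷ ys) ≡ precedes i j ys
precedes-tail ys i≢y j≢y rewrite ≢⇒≡ᵇ-false i≢y | ≢⇒≡ᵇ-false j≢y = refl

posOf-<ᵇ≡precedes : ∀ {i j} w → i ∈ w → j ∈ w → (posOf i w <ᵇ posOf j w) ≡ precedes i j w
posOf-<ᵇ≡precedes {i} {j} (y ∷ ys) i∈ j∈ with i ≟ y | j ≟ y
... | yes refl | yes refl rewrite ≡ᵇ-refl y = refl
... | yes refl | no j≢y
  rewrite posOf-here y ys | posOf-there ys j≢y | precedes-head ys j≢y =
  <⇒<ᵇ-true (s≤s (posOf-positive ys (∈-∷⁻ j∈ j≢y)))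
... | no i≢y | yes refl
  rewrite posOf-here y ys | posOf-there ys i≢y | precedes-head′ ys i≢y = ≤⇒<ᵇ-false {suc (posOf i ys)} (s≤s z≤n)
... | no i≢y | no j≢y
  rewrite posOf-there ys i≢y | posOf-there ys j≢y | precedes-tail ys i≢y j≢y =
  posOf-<ᵇ≡precedes ys (∈-∷⁻ i∈ i≢y) (∈-∷⁻ j∈ j≢y)

module _ {i j : ℕ} where

  precedes-++ʳ : ∀ xs ys → i ∉ xs → j ∉ xs → precedes i j (xs ++ ys) ≡ precedes i j ys
  precedes-++ʳ []       ys _   _   = refl
  precedes-++ʳ (x ∷ xs) ys i∉ j∉
    rewrite precedes-tail (xs ++ ys) (i∉ ∘ here) (j∉ ∘ here) = precedes-++ʳ xs ys (i∉ ∘ there) (j∉ ∘ there)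

  precedes-++⁺ˡ : ∀ xs {ys zs} → (i ∉ xs → j ∉ xs → precedes i j ys ≡ precedes i j zs) →
    precedes i j (xs ++ ys) ≡ precedes i j (xs ++ zs)
  precedes-++⁺ˡ []       ys≈zs = ys≈zs (λ ()) (λ ())
  precedes-++⁺ˡ (x ∷ xs) {ys} {zs} ys≈zs with i ≟ x | j ≟ x
  ... | yes refl | _        rewrite ≡ᵇ-refl i = refl
  ... | no i≢x   | yes refl rewrite ≢⇒≡ᵇ-false i≢x | ≡ᵇ-refl j = refl
  ... | no i≢x   | no j≢x
    rewrite precedes-tail (xs ++ ys) i≢x j≢x | precedes-tail (xs ++ zs) i≢x j≢x =
    precedes-++⁺ˡ xs (λ i∉ j∉ → ys≈zs (∉-∷⁺ i≢x i∉) (∉-∷⁺ j≢x j∉))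

  precedes-++-true : ∀ xs ys → i ∈ xs → j ∉ xs → precedes i j (xs ++ ys) ≡ true
  precedes-++-true (x ∷ xs) ys i∈ j∉ with i ≟ x
  ... | yes refl = precedes-head (xs ++ ys) (j∉ ∘ here)
  ... | no i≢x rewrite precedes-tail (xs ++ ys) i≢x (j∉ ∘ here) =
    precedes-++-true xs ys (∈-∷⁻ i∈ i≢x) (j∉ ∘ there)

  precedes-++-false : ∀ xs ys → i ∉ xs → j ∈ xs → precedes i j (xs ++ ys) ≡ false
  precedes-++-false (x ∷ xs) ys i∉ j∈ with j ≟ x
  ... | yes refl = precedes-head′ (xs ++ ys) (i∉ ∘ here)
  ... | no j≢x rewrite precedes-tail (xs ++ ys) (i∉ ∘ here) j≢x =
    precedes-++-false xs ys (i∉ ∘ there) (∈-∷⁻ j∈ j≢x)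

  precedes-++ˡ : ∀ xs ys → i ∈ xs → j ∈ xs → precedes i j (xs ++ ys) ≡ precedes i j xs
  precedes-++ˡ (x ∷ xs) ys i∈ j∈ with i ≟ x | j ≟ x
  ... | yes refl | yes refl rewrite ≡ᵇ-refl x = refl
  ... | yes refl | no j≢x rewrite precedes-head (xs ++ ys) j≢x | precedes-head xs j≢x = refl
  ... | no i≢x | yes refl rewrite precedes-head′ (xs ++ ys) i≢x | precedes-head′ xs i≢x = refl
  ... | no i≢x | no j≢x rewrite precedes-tail (xs ++ ys) i≢x j≢x | precedes-tail xs i≢x j≢x =
    precedes-++ˡ xs ys (∈-∷⁻ i∈ i≢x) (∈-∷⁻ j∈ j≢x)

applyUpTo-cong : ∀ {A : Set} {f g : ℕ → A} n → (∀ {i} → i < n → f i ≡ g i) → applyUpTo f n ≡ applyUpTo g n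
applyUpTo-cong zero    f≗g = refl
applyUpTo-cong (suc n) f≗g = cong₂ _∷_ (f≗g (s≤s z≤n)) (applyUpTo-cong n (f≗g ∘ s≤s))

-- 0-based, unlike posOf
letterAt : ℕ → List ℕ → ℕ
letterAt i       []       = 0
letterAt zero    (x ∷ xs) = x
letterAt (suc i) (x ∷ xs) = letterAt i xs

letterAt-∈ : ∀ {i} w → i < length w → letterAt i w ∈ w
letterAt-∈ {zero}  (x ∷ xs) _         = here refl
letterAt-∈ {suc i} (x ∷ xs) (s≤s i<) = there (letterAt-∈ xs i<)

posOf-letterAt : ∀ {i} w → Unique w → i < length w → posOf (letterAt i w) w ≡ suc i
posOf-letterAt {zero}  (x ∷ xs) _            _         = posOf-here x xs
posOf-letterAt {suc i} (x ∷ xs) (x∉xs ∷ xs!) (s≤s i<) =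
  trans (posOf-there xs (λ { refl → All¬⇒¬Any x∉xs (letterAt-∈ xs i<) }))
        (cong suc (posOf-letterAt xs xs! i<))

applyUpTo-letterAt : ∀ w → applyUpTo (λ i → letterAt i w) (length w) ≡ w
applyUpTo-letterAt []       = refl
applyUpTo-letterAt (x ∷ xs) = cong (x ∷_) (applyUpTo-letterAt xs)

letterAt-applyUpTo : ∀ (f : ℕ → ℕ) {n i} → i < n → letterAt i (applyUpTo f n) ≡ f i
letterAt-applyUpTo f {suc n} {zero}  _        = refl
letterAt-applyUpTo f {suc n} {suc i} (s≤s i<) = letterAt-applyUpTo (f ∘ suc) i<

posOf-oneTo : ∀ {n v} → v ∈ oneTo n → posOf v (oneTo n) ≡ v
posOf-oneTo {n} v∈ with ∈-applyUpTo⁻ suc v∈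
... | i , i<n , refl =
  subst (λ v → posOf v (oneTo n) ≡ suc i) (letterAt-applyUpTo suc i<n)
    (posOf-letterAt (oneTo n) (Unique-oneTo n) (subst (i <_) (sym (length-oneTo n)) i<n))

posOf-map : ∀ (f : ℕ → ℕ) {v} vs → v ∈ vs → (∀ {u} → u ∈ vs → f u ≡ f v → u ≡ v) →
  posOf (f v) (map f vs) ≡ posOf v vs
posOf-map f {v} (u ∷ vs) v∈ f-inj with v ≟ u
... | yes refl rewrite posOf-here (f v) (map f vs) | posOf-here v vs = refl
... | no v≢u
  rewrite posOf-there (map f vs) (v≢u ∘ sym ∘ f-inj (here refl) ∘ sym) | posOf-there vs v≢u =
  cong suc (posOf-map f vs (∈-∷⁻ v∈ v≢u) (f-inj ∘ there))

inverse≡map-posOf : ∀ {n π} → IsPermutation n π → inverse π ≡ map (λ j → posOf j π) (oneTo n)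
inverse≡map-posOf {π = π} σ = cong (λ m → map (λ j → posOf j π) (oneTo m)) (IsPermutation⇒length σ)

module _ {n : ℕ} {π : List ℕ} (σ : IsPermutation n π) where

  private
    π! : Unique π
    π! = IsPermutation⇒Unique σ

    ∣π∣≡n : length π ≡ n
    ∣π∣≡n = IsPermutation⇒length σ

    ∈π : ∀ {j} → j ∈ oneTo n → j ∈ π
    ∈π = ∈-resp-↭ (↭-sym σ)

  inverse-IsPermutation : IsPermutation n (inverse π)
  inverse-IsPermutation rewrite inverse≡map-posOf σ =
    unique-⊆⇒↭ (Unique-map⁺ _ (λ i∈ j∈ → posOf-injective π (∈π i∈) (∈π j∈)) (Unique-oneTo n))
      (Unique-oneTo n)
      (λ v∈ → let j , j∈ , v≡ = ∈-map⁻ _ v∈ in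
        subst (_∈ oneTo n) (sym v≡)
          (∈-oneTo⁺ (posOf-positive π (∈π j∈)) (subst (posOf j π ≤_) ∣π∣≡n (posOf-≤-length π (∈π j∈)))))
      (≤-reflexive (trans (length-oneTo n) (sym (trans (length-map _ (oneTo n)) (length-oneTo n)))))

  posOf-inverse : ∀ {i} → i < n → posOf (suc i) (inverse π) ≡ letterAt i π
  posOf-inverse {i} i<n = begin
    posOf (suc i) (inverse π)
      ≡⟨ cong₂ posOf (sym (posOf-letterAt π π! i<∣π∣)) (inverse≡map-posOf σ) ⟩
    posOf (posOf v π) (map (λ j → posOf j π) (oneTo n))
      ≡⟨ posOf-map (λ j → posOf j π) (oneTo n) v∈ (λ u∈ → posOf-injective π (∈π u∈) (letterAt-∈ π i<∣π∣)) ⟩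
    posOf v (oneTo n)
      ≡⟨ posOf-oneTo v∈ ⟩
    v ∎
    where
    open ≡-Reasoning
    i<∣π∣ : i < length π
    i<∣π∣ = subst (i <_) (sym ∣π∣≡n) i<n
    v : ℕ
    v = letterAt i π
    v∈ : v ∈ oneTo n
    v∈ = ∈-resp-↭ σ (letterAt-∈ π i<∣π∣)

  inverse-involutive : inverse (inverse π) ≡ π
  inverse-involutive = begin
    inverse (inverse π)
      ≡⟨ inverse≡map-posOf inverse-IsPermutation ⟩
    map (λ j → posOf j (inverse π)) (applyUpTo suc n)
      ≡⟨ map-applyUpTo suc _ n ⟩
    applyUpTo (λ i → posOf (suc i) (inverse π)) n
      ≡⟨ applyUpTo-cong n posOf-inverse ⟩
    applyUpTo (λ i → letterAt i π) n
      ≡⟨ cong (applyUpTo _) (sym ∣π∣≡n) ⟩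
    applyUpTo (λ i → letterAt i π) (length π)
      ≡⟨ applyUpTo-letterAt π ⟩
    π ∎
    where open ≡-Reasoning

sumPairs : (ℕ → ℕ → ℕ) → List ℕ → ℕ
sumPairs F xs = sumBy (λ i → sumBy (F i) xs) xs

sumPairs-∷ : ∀ F y ys →
  sumPairs F (y ∷ ys) ≡ F y y + sumBy (F y) ys + (sumBy (λ i → F i y) ys + sumPairs F ys)
sumPairs-∷ F y ys = cong (F y y + sumBy (F y) ys +_) (sumBy-+ (λ i → F i y) (λ i → sumBy (F i) ys) ys)

sumPairs-↭ : ∀ F {xs ys} → xs ↭ ys → sumPairs F xs ≡ sumPairs F ys
sumPairs-↭ F {ys = ys} xs↭ys = trans (sumBy-↭ _ xs↭ys) (sumBy-cong ys (λ _ → sumBy-↭ _ xs↭ys))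

<ᵇ-irrefl : ∀ n → (n <ᵇ n) ≡ false
<ᵇ-irrefl n = ≤⇒<ᵇ-false (≤-refl {n})

inv≡sumPairs-precedes : ∀ w → Unique w →
  inv w ≡ sumPairs (λ i j → indicator ((j <ᵇ i) ∧ precedes i j w)) w
inv≡sumPairs-precedes []       _            = refl
inv≡sumPairs-precedes (y ∷ ys) (y∉ys ∷ ys!) = sym (begin
  sumPairs F (y ∷ ys)
    ≡⟨ sumPairs-∷ F y ys ⟩
  F y y + sumBy (F y) ys + (sumBy (λ i → F i y) ys + sumPairs F ys)
    ≡⟨ cong₂ _+_ (cong₂ _+_ (cong (λ b → indicator (b ∧ precedes y y (y ∷ ys))) (<ᵇ-irrefl y)) later) (cong₂ _+_ earlier rest) ⟩
  inv (y ∷ ys) ∎)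
  where
  open ≡-Reasoning
  F : ℕ → ℕ → ℕ
  F i j = indicator ((j <ᵇ i) ∧ precedes i j (y ∷ ys))
  ≢y : ∀ {z} → z ∈ ys → z ≢ y
  ≢y z∈ refl = All¬⇒¬Any y∉ys z∈
  later : sumBy (F y) ys ≡ count (λ z → z <ᵇ y) ys
  later = trans (sumBy-cong ys (λ {z} z∈ →
                  trans (cong (λ b → indicator ((z <ᵇ y) ∧ b)) (precedes-head ys (≢y z∈)))
                        (cong indicator (∧-identityʳ (z <ᵇ y)))))
                (sym (count≡sumBy _ ys))
  earlier : sumBy (λ i → F i y) ys ≡ 0
  earlier = trans (sumBy-cong ys (λ {z} z∈ →
                    trans (cong (λ b → indicator ((y <ᵇ z) ∧ b)) (precedes-head′ ys (≢y z∈)))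
                          (cong indicator (∧-zeroʳ (y <ᵇ z)))))
                  (sumBy-zero ys)
  rest : sumPairs F ys ≡ inv ys
  rest = trans (sumBy-cong ys (λ {i} i∈ → sumBy-cong ys (λ {j} j∈ →
                 cong (λ b → indicator ((j <ᵇ i) ∧ b)) (precedes-tail ys (≢y i∈) (≢y j∈)))))
               (sym (inv≡sumPairs-precedes ys ys!))

inv-map-increasing : ∀ (f : ℕ → ℕ) vs → AllPairs _<_ vs →
  inv (map f vs) ≡ sumPairs (λ i j → indicator ((i <ᵇ j) ∧ (f j <ᵇ f i))) vs
inv-map-increasing f []       []             = refl
inv-map-increasing f (v ∷ vs) (v<vs ∷ vs<) = sym (begin
  sumPairs G (v ∷ vs)
    ≡⟨ sumPairs-∷ G v vs ⟩
  G v v + sumBy (G v) vs + (sumBy (λ i → G i v) vs + sumPairs G vs)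
    ≡⟨ cong₂ _+_ (cong₂ _+_ (cong (λ b → indicator (b ∧ (f v <ᵇ f v))) (<ᵇ-irrefl v)) later)
                 (cong₂ _+_ earlier (sym (inv-map-increasing f vs vs<))) ⟩
  inv (map f (v ∷ vs)) ∎)
  where
  open ≡-Reasoning
  G : ℕ → ℕ → ℕ
  G i j = indicator ((i <ᵇ j) ∧ (f j <ᵇ f i))
  later : sumBy (G v) vs ≡ count (λ z → z <ᵇ f v) (map f vs)
  later = trans (sumBy-cong vs (λ {z} z∈ → cong (λ b → indicator (b ∧ (f z <ᵇ f v))) (<⇒<ᵇ-true (All.lookup v<vs z∈))))
                (trans (sym (count≡sumBy _ vs)) (sym (count-map _ f vs)))
  earlier : sumBy (λ i → G i v) vs ≡ 0
  earlier = trans (sumBy-cong vs (λ {z} z∈ →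
                    cong (λ b → indicator (b ∧ (f v <ᵇ f z))) (≤⇒<ᵇ-false (<⇒≤ (All.lookup v<vs z∈)))))
                  (sumBy-zero vs)

inv-inverse : ∀ {n π} → IsPermutation n π → inv (inverse π) ≡ inv π
inv-inverse {n} {π} σ = begin
  inv (inverse π)
    ≡⟨ cong inv (inverse≡map-posOf σ) ⟩
  inv (map pos (oneTo n))
    ≡⟨ inv-map-increasing pos (oneTo n) (oneTo-increasing n) ⟩
  sumPairs (λ i j → indicator ((i <ᵇ j) ∧ (pos j <ᵇ pos i))) (oneTo n)
    ≡⟨ sumBy-cong (oneTo n) (λ i∈ → sumBy-cong (oneTo n) (λ j∈ →
         cong (λ b → indicator (_ ∧ b)) (posOf-<ᵇ≡precedes π (∈π j∈) (∈π i∈)))) ⟩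
  sumBy (λ i → sumBy (λ j → indicator ((i <ᵇ j) ∧ precedes j i π)) (oneTo n)) (oneTo n)
    ≡⟨ sumBy-comm _ (oneTo n) (oneTo n) ⟩
  sumPairs (λ j i → indicator ((i <ᵇ j) ∧ precedes j i π)) (oneTo n)
    ≡⟨ sumPairs-↭ _ (↭-sym σ) ⟩
  sumPairs (λ j i → indicator ((i <ᵇ j) ∧ precedes j i π)) π
    ≡⟨ inv≡sumPairs-precedes π (IsPermutation⇒Unique σ) ⟨
  inv π ∎
  where
  open ≡-Reasoning
  pos : ℕ → ℕ
  pos j = posOf j π
  ∈π : ∀ {j} → j ∈ oneTo n → j ∈ π
  ∈π = ∈-resp-↭ (↭-sym σ)

crossInversions : List ℕ → List ℕ → ℕ
crossInversions xs ys = sumBy (λ a → count (_<ᵇ a) ys) xs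

inv-++ : ∀ xs ys → inv (xs ++ ys) ≡ inv xs + inv ys + crossInversions xs ys
inv-++ []       ys = sym (+-identityʳ (inv ys))
inv-++ (x ∷ xs) ys = begin
  count (_<ᵇ x) (xs ++ ys) + inv (xs ++ ys)
    ≡⟨ cong₂ _+_ (count-++ (_<ᵇ x) xs ys) (inv-++ xs ys) ⟩
  count (_<ᵇ x) xs + count (_<ᵇ x) ys + (inv xs + inv ys + crossInversions xs ys)
    ≡⟨ rearrange (count (_<ᵇ x) xs) (count (_<ᵇ x) ys) (inv xs) (inv ys) (crossInversions xs ys) ⟩
  count (_<ᵇ x) xs + inv xs + inv ys + (count (_<ᵇ x) ys + crossInversions xs ys) ∎
  where
  open ≡-Reasoning
  rearrange : ∀ a b c d e → a + b + (c + d + e) ≡ a + c + d + (b + e)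
  rearrange = solve-∀

crossInversions-↭ʳ : ∀ xs {ys zs} → ys ↭ zs → crossInversions xs ys ≡ crossInversions xs zs
crossInversions-↭ʳ xs ys↭zs = sumBy-cong xs (λ {a} _ → count-↭ (_<ᵇ a) ys↭zs)

crossInversions-∷ʳ : ∀ xs y ys → crossInversions xs (y ∷ ys) ≡ count (y <ᵇ_) xs + crossInversions xs ys
crossInversions-∷ʳ xs y ys =
  trans (sumBy-+ (λ a → indicator (y <ᵇ a)) (λ a → count (_<ᵇ a) ys) xs)
        (cong (_+ crossInversions xs ys) (sym (count≡sumBy (y <ᵇ_) xs)))

lastLetter : List ℕ → ℕ
lastLetter []           = 0
lastLetter (y ∷ [])     = y
lastLetter (y ∷ z ∷ zs) = lastLetter (z ∷ zs)

lastLetter-∷ʳ : ∀ xs x → lastLetter (xs ++ [ x ]) ≡ x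
lastLetter-∷ʳ []           x = refl
lastLetter-∷ʳ (y ∷ [])     x = refl
lastLetter-∷ʳ (y ∷ z ∷ zs) x = lastLetter-∷ʳ (z ∷ zs) x

-- Cut after every letter satisfying P and move each block's last letter to its front;
-- acc is the block still open.
rotateBlocks : (ℕ → Bool) → List ℕ → List ℕ → List ℕ
rotateBlocks P acc []       = acc
rotateBlocks P acc (y ∷ ys) = if P y then y ∷ (acc ++ rotateBlocks P [] ys) else rotateBlocks P (acc ++ [ y ]) ys

unrotateBlocks : (ℕ → Bool) → List ℕ → List ℕ → List ℕ
unrotateBlocks P pending []       = pending
unrotateBlocks P pending (y ∷ ys) = if P y then pending ++ unrotateBlocks P [ y ] ys else y ∷ unrotateBlocks P pending ys

-- acc ++ u ends with a letter satisfying P, so no block is left open.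
BlocksClosed : (ℕ → Bool) → List ℕ → List ℕ → Set
BlocksClosed P acc []       = acc ≡ []
BlocksClosed P acc (y ∷ ys) = P (lastLetter (y ∷ ys)) ≡ true

Uncut : (ℕ → Bool) → List ℕ → Set
Uncut P = All (λ a → P a ≡ false)

module _ (P : ℕ → Bool) where

  BlocksClosed-tail : ∀ acc y ys → BlocksClosed P acc (y ∷ ys) → BlocksClosed P [] ys
  BlocksClosed-tail acc y []       _      = refl
  BlocksClosed-tail acc y (z ∷ zs) closed = closed

  BlocksClosed-shift : ∀ acc y ys → P y ≡ false → BlocksClosed P acc (y ∷ ys) → BlocksClosed P (acc ++ [ y ]) ys
  BlocksClosed-shift acc y []       Py≡false Py≡true with () ← trans (sym Py≡false) Py≡true
  BlocksClosed-shift acc y (z ∷ zs) _        closed  = closed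

  rotateBlocks-↭ : ∀ acc u → rotateBlocks P acc u ↭ acc ++ u
  rotateBlocks-↭ acc []       = subst (acc ↭_) (sym (++-identityʳ acc)) ↭-refl
  rotateBlocks-↭ acc (y ∷ ys) with P y
  ... | true  = ↭-trans (↭-prep y (++⁺ˡ acc (rotateBlocks-↭ [] ys))) (↭-sym (shift y acc ys))
  ... | false = subst (rotateBlocks P (acc ++ [ y ]) ys ↭_) (++-assoc acc [ y ] ys) (rotateBlocks-↭ (acc ++ [ y ]) ys)

  rotateBlocks-head : ∀ acc y ys → BlocksClosed P acc (y ∷ ys) →
    ∃₂ λ z zs → rotateBlocks P acc (y ∷ ys) ≡ z ∷ zs × P z ≡ true
  rotateBlocks-head acc y ys closed with P y in Py
  ... | true  = y , _ , refl , Py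
  rotateBlocks-head acc y []       closed | false with () ← trans (sym Py) closed
  rotateBlocks-head acc y (z ∷ zs) closed | false =
    rotateBlocks-head (acc ++ [ y ]) z zs (BlocksClosed-shift acc y (z ∷ zs) Py closed)

  unrotateBlocks-uncut : ∀ pending acc r → Uncut P acc →
    unrotateBlocks P pending (acc ++ r) ≡ acc ++ unrotateBlocks P pending r
  unrotateBlocks-uncut pending []        r _               = refl
  unrotateBlocks-uncut pending (a ∷ acc) r (Pa≡false ∷ uncut) rewrite Pa≡false =
    cong (a ∷_) (unrotateBlocks-uncut pending acc r uncut)

  unrotateBlocks-cut : ∀ pending y r → P y ≡ true →
    unrotateBlocks P pending (y ∷ r) ≡ pending ++ unrotateBlocks P [ y ] r
  unrotateBlocks-cut pending y r Py≡true rewrite Py≡true = refl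

  unrotateBlocks-rotateBlocks : ∀ pending acc u → Uncut P acc → BlocksClosed P acc u →
    unrotateBlocks P pending (rotateBlocks P acc u) ≡ pending ++ acc ++ u
  unrotateBlocks-rotateBlocks pending acc []       _     refl   = sym (++-identityʳ pending)
  unrotateBlocks-rotateBlocks pending acc (y ∷ ys) uncut closed with P y in Py
  ... | true  = begin
    unrotateBlocks P pending (y ∷ acc ++ rotateBlocks P [] ys)
      ≡⟨ unrotateBlocks-cut pending y (acc ++ rotateBlocks P [] ys) Py ⟩
    pending ++ unrotateBlocks P [ y ] (acc ++ rotateBlocks P [] ys)
      ≡⟨ cong (pending ++_) (unrotateBlocks-uncut [ y ] acc _ uncut) ⟩
    pending ++ acc ++ unrotateBlocks P [ y ] (rotateBlocks P [] ys)
      ≡⟨ cong (λ r → pending ++ acc ++ r) (unrotateBlocks-rotateBlocks [ y ] [] ys [] (BlocksClosed-tail acc y ys closed)) ⟩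
    pending ++ acc ++ y ∷ ys ∎
    where open ≡-Reasoning
  ... | false = trans
    (unrotateBlocks-rotateBlocks pending (acc ++ [ y ]) ys (Allₚ.++⁺ uncut (Py ∷ [])) (BlocksClosed-shift acc y ys Py closed))
    (cong (pending ++_) (++-assoc acc [ y ] ys))

  cut∉uncut : ∀ {acc z} → Uncut P acc → P z ≡ true → z ∉ acc
  cut∉uncut uncut Pz≡true z∈acc with () ← trans (sym Pz≡true) (All.lookup uncut z∈acc)

  rotateBlocks-precedes : ∀ acc u {i j} → Uncut P acc → i ∈ acc ++ u → j ∈ acc ++ u → i ≢ j → P i ≡ P j →
    precedes i j (rotateBlocks P acc u) ≡ precedes i j (acc ++ u)
  rotateBlocks-precedes acc [] {i} {j} _ _ _ _ _ = cong (precedes i j) (sym (++-identityʳ acc))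
  rotateBlocks-precedes acc (y ∷ ys) {i} {j} uncut i∈ j∈ i≢j Pi≡Pj with P y in Py
  ... | false = trans
    (rotateBlocks-precedes (acc ++ [ y ]) ys (Allₚ.++⁺ uncut (Py ∷ [])) (reassoc i∈) (reassoc j∈) i≢j Pi≡Pj)
    (cong (precedes i j) (++-assoc acc [ y ] ys))
    where
    reassoc : ∀ {z} → z ∈ acc ++ y ∷ ys → z ∈ (acc ++ [ y ]) ++ ys
    reassoc = subst (_ ∈_) (sym (++-assoc acc [ y ] ys))
  ... | true with i ≟ y | j ≟ y
  ...   | yes refl | yes refl = ⊥-elim (i≢j refl)
  ...   | yes refl | no j≢y = begin
    precedes y j (y ∷ acc ++ rotateBlocks P [] ys)
      ≡⟨ precedes-head (acc ++ rotateBlocks P [] ys) j≢y ⟩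
    true
      ≡⟨ precedes-head ys j≢y ⟨
    precedes y j (y ∷ ys)
      ≡⟨ precedes-++ʳ acc (y ∷ ys) (cut∉uncut uncut Py) (cut∉uncut uncut (trans (sym Pi≡Pj) Py)) ⟨
    precedes y j (acc ++ y ∷ ys) ∎
    where open ≡-Reasoning
  ...   | no i≢y | yes refl = begin
    precedes i y (y ∷ acc ++ rotateBlocks P [] ys)
      ≡⟨ precedes-head′ (acc ++ rotateBlocks P [] ys) i≢y ⟩
    false
      ≡⟨ precedes-head′ ys i≢y ⟨
    precedes i y (y ∷ ys)
      ≡⟨ precedes-++ʳ acc (y ∷ ys) (cut∉uncut uncut (trans Pi≡Pj Py)) (cut∉uncut uncut Py) ⟨
    precedes i y (acc ++ y ∷ ys) ∎
    where open ≡-Reasoning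
  ...   | no i≢y | no j≢y = trans (precedes-tail (acc ++ rotateBlocks P [] ys) i≢y j≢y)
    (precedes-++⁺ˡ acc {rotateBlocks P [] ys} (λ i∉ j∉ →
      trans (rotateBlocks-precedes [] ys [] (∈ys i∈ i∉ i≢y) (∈ys j∈ j∉ j≢y) i≢j Pi≡Pj)
            (sym (precedes-tail ys i≢y j≢y))))
    where
    ∈ys : ∀ {z} → z ∈ acc ++ y ∷ ys → z ∉ acc → z ≢ y → z ∈ ys
    ∈ys z∈ z∉acc z≢y with ∈-++⁻ acc z∈
    ... | inj₁ z∈acc = ⊥-elim (z∉acc z∈acc)
    ... | inj₂ z∈y∷ys = ∈-∷⁻ z∈y∷ys z≢y

-- Rotating a block b₁⋯bₖy with all bᵢ ≤ x < y creates the k inversions (y, bᵢ).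
inv-rotateBlocks-above : ∀ x acc u → Uncut (x <ᵇ_) acc → BlocksClosed (x <ᵇ_) acc u →
  inv (rotateBlocks (x <ᵇ_) acc u) ≡ inv (acc ++ u) + count (not ∘ (x <ᵇ_)) (acc ++ u)
inv-rotateBlocks-above x acc []       _     refl   = refl
inv-rotateBlocks-above x acc (y ∷ ys) uncut closed with x <ᵇ y in x<ᵇy
... | true = begin
  count (_<ᵇ y) (acc ++ R) + inv (acc ++ R)
    ≡⟨ cong₂ _+_ acc<y (trans (inv-++ acc R) (cong₂ (λ a b → inv acc + a + b) IH (crossInversions-↭ʳ acc R↭ys))) ⟩
  length acc + count (_<ᵇ y) ys + (inv acc + (inv ys + low ys) + crossInversions acc ys)
    ≡⟨ rearrange (length acc) (count (_<ᵇ y) ys) (inv acc) (inv ys) (low ys) (crossInversions acc ys) ⟩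
  inv acc + (count (_<ᵇ y) ys + inv ys) + (0 + crossInversions acc ys) + (length acc + (0 + low ys))
    ≡⟨ cong₂ _+_ (trans (inv-++ acc (y ∷ ys)) (cong (inv acc + inv (y ∷ ys) +_) y<acc)) low-acc ⟨
  inv (acc ++ y ∷ ys) + low (acc ++ y ∷ ys) ∎
  where
  open ≡-Reasoning
  low : List ℕ → ℕ
  low = count (not ∘ (x <ᵇ_))
  R : List ℕ
  R = rotateBlocks (x <ᵇ_) [] ys
  R↭ys : R ↭ ys
  R↭ys = rotateBlocks-↭ (x <ᵇ_) [] ys
  IH : inv R ≡ inv ys + low ys
  IH = inv-rotateBlocks-above x [] ys [] (BlocksClosed-tail (x <ᵇ_) acc y ys closed)
  a<y : ∀ {a} → a ∈ acc → a < y
  a<y a∈ = ≤-<-trans (<ᵇ-false⇒≥ (All.lookup uncut a∈)) (<ᵇ-true⇒< x<ᵇy)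
  acc<y : count (_<ᵇ y) (acc ++ R) ≡ length acc + count (_<ᵇ y) ys
  acc<y = trans (count-++ (_<ᵇ y) acc R)
                (cong₂ _+_ (count-all-true _ (All.tabulate (<⇒<ᵇ-true ∘ a<y))) (count-↭ _ R↭ys))
  y<acc : crossInversions acc (y ∷ ys) ≡ 0 + crossInversions acc ys
  y<acc = trans (crossInversions-∷ʳ acc y ys)
                (cong (_+ _) (count-all-false _ (All.tabulate (≤⇒<ᵇ-false ∘ <⇒≤ ∘ a<y))))
  low-acc : low (acc ++ y ∷ ys) ≡ length acc + (0 + low ys)
  low-acc = trans (count-++ _ acc (y ∷ ys))
                  (cong₂ _+_ (count-all-true _ (All.tabulate (cong not ∘ All.lookup uncut)))
                             (cong (λ b → indicator (not b) + low ys) x<ᵇy))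
  rearrange : ∀ a c ia iy cp cr → a + c + (ia + (iy + cp) + cr) ≡ ia + (c + iy) + (0 + cr) + (a + (0 + cp))
  rearrange = solve-∀
... | false = trans
  (inv-rotateBlocks-above x (acc ++ [ y ]) ys (Allₚ.++⁺ uncut (x<ᵇy ∷ [])) (BlocksClosed-shift _ acc y ys x<ᵇy closed))
  (cong (λ w → inv w + count (not ∘ (x <ᵇ_)) w) (++-assoc acc [ y ] ys))

-- Rotating a block b₁⋯bₖy with y ≤ x < all bᵢ destroys the k inversions (bᵢ, y).
inv-rotateBlocks-below : ∀ x acc u → Uncut (not ∘ (x <ᵇ_)) acc → BlocksClosed (not ∘ (x <ᵇ_)) acc u →
  inv (rotateBlocks (not ∘ (x <ᵇ_)) acc u) + count (x <ᵇ_) (acc ++ u) ≡ inv (acc ++ u)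
inv-rotateBlocks-below x acc []       _     refl   = refl
inv-rotateBlocks-below x acc (y ∷ ys) uncut closed with x <ᵇ y in x<ᵇy
... | false = begin
  count (_<ᵇ y) (acc ++ R) + inv (acc ++ R) + high (acc ++ y ∷ ys)
    ≡⟨ cong₂ _+_ (cong₂ _+_ y<acc (trans (inv-++ acc R) (cong (inv acc + inv R +_) (crossInversions-↭ʳ acc R↭ys)))) high-acc ⟩
  0 + count (_<ᵇ y) ys + (inv acc + inv R + crossInversions acc ys) + (length acc + (0 + high ys))
    ≡⟨ rearrange (length acc) (count (_<ᵇ y) ys) (inv acc) (inv R) (crossInversions acc ys) (high ys) ⟩
  inv acc + (count (_<ᵇ y) ys + (inv R + high ys)) + (length acc + crossInversions acc ys)
    ≡⟨ cong₂ (λ a b → inv acc + (count (_<ᵇ y) ys + a) + b) IH (sym y<acc′) ⟩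
  inv acc + inv (y ∷ ys) + crossInversions acc (y ∷ ys)
    ≡⟨ inv-++ acc (y ∷ ys) ⟨
  inv (acc ++ y ∷ ys) ∎
  where
  open ≡-Reasoning
  high : List ℕ → ℕ
  high = count (x <ᵇ_)
  R : List ℕ
  R = rotateBlocks (not ∘ (x <ᵇ_)) [] ys
  R↭ys : R ↭ ys
  R↭ys = rotateBlocks-↭ (not ∘ (x <ᵇ_)) [] ys
  IH : inv R + high ys ≡ inv ys
  IH = inv-rotateBlocks-below x [] ys [] (BlocksClosed-tail _ acc y ys closed)
  x<a : ∀ {a} → a ∈ acc → x < a
  x<a a∈ = <ᵇ-true⇒< (not-injective (All.lookup uncut a∈))
  y<a : ∀ {a} → a ∈ acc → y < a
  y<a a∈ = ≤-<-trans (<ᵇ-false⇒≥ x<ᵇy) (x<a a∈)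
  y<acc : count (_<ᵇ y) (acc ++ R) ≡ 0 + count (_<ᵇ y) ys
  y<acc = trans (count-++ (_<ᵇ y) acc R)
                (cong₂ _+_ (count-all-false _ (All.tabulate (≤⇒<ᵇ-false ∘ <⇒≤ ∘ y<a))) (count-↭ _ R↭ys))
  y<acc′ : crossInversions acc (y ∷ ys) ≡ length acc + crossInversions acc ys
  y<acc′ = trans (crossInversions-∷ʳ acc y ys) (cong (_+ _) (count-all-true _ (All.tabulate (<⇒<ᵇ-true ∘ y<a))))
  high-acc : high (acc ++ y ∷ ys) ≡ length acc + (0 + high ys)
  high-acc = trans (count-++ _ acc (y ∷ ys))
                   (cong₂ _+_ (count-all-true _ (All.tabulate (<⇒<ᵇ-true ∘ x<a)))
                              (cong (λ b → indicator b + high ys) x<ᵇy))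
  rearrange : ∀ a c ia iR cr ch → 0 + c + (ia + iR + cr) + (a + (0 + ch)) ≡ ia + (c + (iR + ch)) + (a + cr)
  rearrange = solve-∀
... | true = begin
  inv (rotateBlocks (not ∘ (x <ᵇ_)) (acc ++ [ y ]) ys) + count (x <ᵇ_) (acc ++ y ∷ ys)
    ≡⟨ cong (λ w → inv (rotateBlocks (not ∘ (x <ᵇ_)) (acc ++ [ y ]) ys) + count (x <ᵇ_) w) (++-assoc acc [ y ] ys) ⟨
  inv (rotateBlocks (not ∘ (x <ᵇ_)) (acc ++ [ y ]) ys) + count (x <ᵇ_) ((acc ++ [ y ]) ++ ys)
    ≡⟨ inv-rotateBlocks-below x (acc ++ [ y ]) ys (Allₚ.++⁺ uncut (cong not x<ᵇy ∷ [])) (BlocksClosed-shift _ acc y ys (cong not x<ᵇy) closed) ⟩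
  inv ((acc ++ [ y ]) ++ ys)
    ≡⟨ cong inv (++-assoc acc [ y ] ys) ⟩
  inv (acc ++ y ∷ ys) ∎
  where open ≡-Reasoning

onSide : Bool → ℕ → ℕ → Bool
onSide c x y = if c then x <ᵇ y else not (x <ᵇ y)

onSide-self : ∀ x z → onSide (x <ᵇ z) x z ≡ true
onSide-self x z with x <ᵇ z
... | true  = refl
... | false = refl

onSide⇒<ᵇ : ∀ c x z → onSide c x z ≡ true → (x <ᵇ z) ≡ c
onSide⇒<ᵇ true  x z onSide≡ = onSide≡
onSide⇒<ᵇ false x z onSide≡ = not-injective onSide≡

<ᵇ-suc : ∀ {x i} → x ≢ i → (x <ᵇ i) ≡ (x <ᵇ suc i)
<ᵇ-suc {x} {i} x≢i with <-cmp x i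
... | tri< x<i _ _ = trans (<⇒<ᵇ-true x<i) (sym (<⇒<ᵇ-true (m<n⇒m<1+n x<i)))
... | tri≈ _ x≡i _ = ⊥-elim (x≢i x≡i)
... | tri> _ _ i<x = trans (≤⇒<ᵇ-false (<⇒≤ i<x)) (sym (≤⇒<ᵇ-false i<x))

onSide-suc : ∀ c {x i} → x ≢ i → onSide c x i ≡ onSide c x (suc i)
onSide-suc c x≢i = cong (λ b → if c then b else not b) (<ᵇ-suc x≢i)

-- Foata's transformation γₓ: cut u after every letter on the same side of x as its last letter.
γ : ℕ → List ℕ → List ℕ
γ x u = rotateBlocks (onSide (x <ᵇ lastLetter u) x) [] u

γ-closed : ∀ x u → BlocksClosed (onSide (x <ᵇ lastLetter u) x) [] u
γ-closed x []       = refl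
γ-closed x (y ∷ ys) = onSide-self x (lastLetter (y ∷ ys))

-- The first letter of γₓ u lies on the side of x used for the cuts, so the cuts can be recovered.
γ⁻¹ : ℕ → List ℕ → List ℕ
γ⁻¹ x []       = []
γ⁻¹ x (z ∷ zs) = unrotateBlocks (onSide (x <ᵇ z) x) [] (z ∷ zs)

γ⁻¹-γ : ∀ x u → γ⁻¹ x (γ x u) ≡ u
γ⁻¹-γ x []       = refl
γ⁻¹-γ x u@(y ∷ ys) with rotateBlocks-head (onSide (x <ᵇ lastLetter u) x) [] y ys (γ-closed x u)
... | z , zs , γ≡ , onSide≡ = begin
  γ⁻¹ x (γ x u)
    ≡⟨ cong (γ⁻¹ x) γ≡ ⟩
  unrotateBlocks (onSide (x <ᵇ z) x) [] (z ∷ zs)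
    ≡⟨ cong (λ c → unrotateBlocks (onSide c x) [] (z ∷ zs)) (onSide⇒<ᵇ _ x z onSide≡) ⟩
  unrotateBlocks (onSide (x <ᵇ lastLetter u) x) [] (z ∷ zs)
    ≡⟨ cong (unrotateBlocks _ []) γ≡ ⟨
  unrotateBlocks (onSide (x <ᵇ lastLetter u) x) [] (γ x u)
    ≡⟨ unrotateBlocks-rotateBlocks (onSide (x <ᵇ lastLetter u) x) [] [] u [] (γ-closed x u) ⟩
  u ∎
  where open ≡-Reasoning

foataStep : List ℕ → ℕ → List ℕ
foataStep u x = γ x u ++ [ x ]

foata : List ℕ → List ℕ
foata = foldl foataStep []

foataStep-injective : ∀ {u u′ x x′} → foataStep u x ≡ foataStep u′ x′ → u ≡ u′ × x ≡ x′
foataStep-injective {u} {u′} {x} {x′} eq with ∷ʳ-injective (γ x u) (γ x′ u′) eq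
... | γ≡ , refl = trans (sym (γ⁻¹-γ x u)) (trans (cong (γ⁻¹ x) γ≡) (γ⁻¹-γ x u′)) , refl

γ-↭ : ∀ x u → γ x u ↭ u
γ-↭ x u = rotateBlocks-↭ (onSide (x <ᵇ lastLetter u) x) [] u

inv-foataStep : ∀ u x → inv (foataStep u x) ≡ inv u + (if x <ᵇ lastLetter u then length u else 0)
inv-foataStep u x = begin
  inv (γ x u ++ [ x ])
    ≡⟨ inv-++ (γ x u) [ x ] ⟩
  inv (γ x u) + 0 + crossInversions (γ x u) [ x ]
    ≡⟨ cong₂ _+_ (+-identityʳ _) (trans (crossInversions-∷ʳ (γ x u) x []) (cong₂ _+_ (count-↭ _ (γ-↭ x u)) (sumBy-zero (γ x u)))) ⟩
  inv (γ x u) + (count (x <ᵇ_) u + 0)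
    ≡⟨ cong (inv (γ x u) +_) (+-identityʳ _) ⟩
  inv (γ x u) + count (x <ᵇ_) u
    ≡⟨ by-side (x <ᵇ lastLetter u) refl ⟩
  inv u + (if x <ᵇ lastLetter u then length u else 0) ∎
  where
  open ≡-Reasoning
  by-side : ∀ c → (x <ᵇ lastLetter u) ≡ c → inv (γ x u) + count (x <ᵇ_) u ≡ inv u + (if c then length u else 0)
  by-side true  c≡ = begin
    inv (γ x u) + count (x <ᵇ_) u
      ≡⟨ cong (λ c → inv (rotateBlocks (onSide c x) [] u) + count (x <ᵇ_) u) c≡ ⟩
    inv (rotateBlocks (x <ᵇ_) [] u) + count (x <ᵇ_) u
      ≡⟨ cong (_+ count (x <ᵇ_) u) (inv-rotateBlocks-above x [] u [] (subst (λ c → BlocksClosed (onSide c x) [] u) c≡ (γ-closed x u))) ⟩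
    inv u + count (not ∘ (x <ᵇ_)) u + count (x <ᵇ_) u
      ≡⟨ +-assoc (inv u) _ _ ⟩
    inv u + (count (not ∘ (x <ᵇ_)) u + count (x <ᵇ_) u)
      ≡⟨ cong (inv u +_) (+-comm (count (not ∘ (x <ᵇ_)) u) _) ⟩
    inv u + (count (x <ᵇ_) u + count (not ∘ (x <ᵇ_)) u)
      ≡⟨ cong (inv u +_) (count-+-count-not (x <ᵇ_) u) ⟩
    inv u + length u ∎
  by-side false c≡ = begin
    inv (γ x u) + count (x <ᵇ_) u
      ≡⟨ cong (λ c → inv (rotateBlocks (onSide c x) [] u) + count (x <ᵇ_) u) c≡ ⟩
    inv (rotateBlocks (not ∘ (x <ᵇ_)) [] u) + count (x <ᵇ_) u
      ≡⟨ inv-rotateBlocks-below x [] u [] (subst (λ c → BlocksClosed (onSide c x) [] u) c≡ (γ-closed x u)) ⟩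
    inv u
      ≡⟨ +-identityʳ (inv u) ⟨
    inv u + 0 ∎

maj : List ℕ → ℕ
maj w = sum (DES w)

sum-desFrom-∷ʳ : ∀ i y v x →
  sum (desFrom i ((y ∷ v) ++ [ x ])) ≡ sum (desFrom i (y ∷ v)) + (if x <ᵇ lastLetter (y ∷ v) then i + length v else 0)
sum-desFrom-∷ʳ i y []       x with x <ᵇ y
... | true  = refl
... | false = refl
sum-desFrom-∷ʳ i y (z ∷ v) x with z <ᵇ y
... | true  = trans (cong (i +_) (trans (sum-desFrom-∷ʳ (suc i) z v x) (cong (_ +_) i+1+∣v∣≡)))
                    (sym (+-assoc i _ _))
  where i+1+∣v∣≡ = cong (λ n → if x <ᵇ lastLetter (z ∷ v) then n else 0) (sym (+-suc i (length v)))
... | false = trans (sum-desFrom-∷ʳ (suc i) z v x) (cong (_ +_) i+1+∣v∣≡)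
  where i+1+∣v∣≡ = cong (λ n → if x <ᵇ lastLetter (z ∷ v) then n else 0) (sym (+-suc i (length v)))

maj-∷ʳ : ∀ v x → maj (v ++ [ x ]) ≡ maj v + (if x <ᵇ lastLetter v then length v else 0)
maj-∷ʳ []      x = refl
maj-∷ʳ (y ∷ v) x = sum-desFrom-∷ʳ 1 y v x

record FoataInvariant (u v : List ℕ) : Set where
  field
    permutes       : u ↭ v
    inv≡maj        : inv u ≡ maj v
    lastLetter≡    : lastLetter u ≡ lastLetter v
    precedes-suc≡ : ∀ {i} → i ∈ v → suc i ∈ v → precedes i (suc i) u ≡ precedes i (suc i) v

foataStep-invariant : ∀ {u v} x → Unique (v ++ [ x ]) → FoataInvariant u v → FoataInvariant (foataStep u x) (v ++ [ x ])
foataStep-invariant {u} {v} x v++x! I = record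
  { permutes       = ++⁺ʳ [ x ] (↭-trans (γ-↭ x u) permutes)
  ; inv≡maj        = begin
      inv (foataStep u x)
        ≡⟨ inv-foataStep u x ⟩
      inv u + (if x <ᵇ lastLetter u then length u else 0)
        ≡⟨ cong₂ (λ m ℓ → m + (if x <ᵇ ℓ then length u else 0)) inv≡maj lastLetter≡ ⟩
      maj v + (if x <ᵇ lastLetter v then length u else 0)
        ≡⟨ cong (λ n → maj v + (if x <ᵇ lastLetter v then n else 0)) (↭-length permutes) ⟩
      maj v + (if x <ᵇ lastLetter v then length v else 0)
        ≡⟨ maj-∷ʳ v x ⟨
      maj (v ++ [ x ]) ∎
  ; lastLetter≡    = trans (lastLetter-∷ʳ (γ x u) x) (sym (lastLetter-∷ʳ v x))
  ; precedes-suc≡ = λ {i} → precedes-suc≡′ i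
  }
  where
  open ≡-Reasoning
  open FoataInvariant I
  x∉v : x ∉ v
  x∉v with Unique-resp-↭ (↭-sym (∷↭∷ʳ x v)) v++x!
  ... | x∉ ∷ _ = All¬⇒¬Any x∉
  ∈γ : ∀ {z} → z ∈ v → z ∈ γ x u
  ∈γ = ∈-resp-↭ (↭-sym (↭-trans (γ-↭ x u) permutes))
  ∈u : ∀ {z} → z ∈ v → z ∈ u
  ∈u = ∈-resp-↭ (↭-sym permutes)
  x∉γ : x ∉ γ x u
  x∉γ = x∉v ∘ ∈-resp-↭ (↭-trans (γ-↭ x u) permutes)
  precedes-suc≡′ : ∀ i → i ∈ v ++ [ x ] → suc i ∈ v ++ [ x ] →
    precedes i (suc i) (γ x u ++ [ x ]) ≡ precedes i (suc i) (v ++ [ x ])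
  precedes-suc≡′ i i∈ i+1∈ with ∈-++⁻ v i∈ | ∈-++⁻ v i+1∈
  ... | inj₁ i∈v | inj₁ i+1∈v = begin
    precedes i (suc i) (γ x u ++ [ x ])
      ≡⟨ precedes-++ˡ (γ x u) [ x ] (∈γ i∈v) (∈γ i+1∈v) ⟩
    precedes i (suc i) (γ x u)
      ≡⟨ rotateBlocks-precedes _ [] u [] (∈u i∈v) (∈u i+1∈v) (<⇒≢ (n<1+n i))
                                               (onSide-suc (x <ᵇ lastLetter u) {x} {i} (λ { refl → x∉v i∈v })) ⟩
    precedes i (suc i) u
      ≡⟨ precedes-suc≡ i∈v i+1∈v ⟩
    precedes i (suc i) v
      ≡⟨ precedes-++ˡ v [ x ] i∈v i+1∈v ⟨
    precedes i (suc i) (v ++ [ x ]) ∎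
  ... | inj₁ i∈v | inj₂ (here refl) =
    trans (precedes-++-true (γ x u) [ x ] (∈γ i∈v) x∉γ) (sym (precedes-++-true v [ x ] i∈v x∉v))
  ... | inj₂ (here refl) | inj₁ i+1∈v =
    trans (precedes-++-false (γ x u) [ x ] x∉γ (∈γ i+1∈v)) (sym (precedes-++-false v [ x ] x∉v i+1∈v))
  ... | inj₂ (here refl) | inj₂ (here i+1≡i) = ⊥-elim (<⇒≢ (n<1+n i) (sym i+1≡i))

foldl-foataStep-invariant : ∀ w {u v} → Unique (v ++ w) → FoataInvariant u v →
  FoataInvariant (foldl foataStep u w) (v ++ w)
foldl-foataStep-invariant []      {u} {v} _     I = subst (FoataInvariant u) (sym (++-identityʳ v)) I
foldl-foataStep-invariant (x ∷ w) {u} {v} v++w! I =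
  subst (FoataInvariant _) (++-assoc v [ x ] w)
    (foldl-foataStep-invariant w v++x++w! (foataStep-invariant x (Unique-++⁻ˡ (v ++ [ x ]) v++x++w!) I))
  where
  v++x++w! : Unique ((v ++ [ x ]) ++ w)
  v++x++w! = subst Unique (sym (++-assoc v [ x ] w)) v++w!

foata-invariant : ∀ w → Unique w → FoataInvariant (foata w) w
foata-invariant w w! = foldl-foataStep-invariant w w! record
  { permutes = ↭-refl ; inv≡maj = refl ; lastLetter≡ = refl ; precedes-suc≡ = λ _ _ → refl }

foldl-injective : ∀ {A B : Set} (f : A → B → A) → (∀ {a a′ b b′} → f a b ≡ f a′ b′ → a ≡ a′ × b ≡ b′) →
  ∀ {a a′} bs bs′ → length bs ≡ length bs′ → foldl f a bs ≡ foldl f a′ bs′ → a ≡ a′ × bs ≡ bs′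
foldl-injective f f-inj []       []         _     eq = eq , refl
foldl-injective f f-inj (b ∷ bs) (b′ ∷ bs′) ∣bs∣≡ eq
  with foldl-injective f f-inj bs bs′ (suc-injective ∣bs∣≡) eq
... | fab≡ , refl with f-inj fab≡
...   | refl , refl = refl , refl

foata-injective : ∀ {w w′} → length w ≡ length w′ → foata w ≡ foata w′ → w ≡ w′
foata-injective {w} {w′} ∣w∣≡ eq = proj₂ (foldl-injective foataStep foataStep-injective w w′ ∣w∣≡ eq)

data SameAscents : List ℕ → List ℕ → Set where
  []  : SameAscents [] []
  [-] : ∀ {x x′} → SameAscents [ x ] [ x′ ]
  _∷_ : ∀ {x y ys x′ y′ ys′} → (x <ᵇ y) ≡ (x′ <ᵇ y′) → SameAscents (y ∷ ys) (y′ ∷ ys′) →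
        SameAscents (x ∷ y ∷ ys) (x′ ∷ y′ ∷ ys′)

SameAscents-length : ∀ {w w′} → SameAscents w w′ → length w ≡ length w′
SameAscents-length []        = refl
SameAscents-length [-]        = refl
SameAscents-length (_ ∷ w~w′) = cong suc (SameAscents-length w~w′)

SameAscents-tail : ∀ {x x′ xs xs′} → SameAscents (x ∷ xs) (x′ ∷ xs′) → SameAscents xs xs′
SameAscents-tail [-]        = []
SameAscents-tail (_ ∷ w~w′) = w~w′

firstAscent-cong : ∀ {w w′} → SameAscents w w′ → firstAscent w ≡ firstAscent w′
firstAscent-cong []          = refl
firstAscent-cong [-]         = refl
firstAscent-cong (<≡ ∷ w~w′) = cong₂ (λ b n → if b then 1 else suc n) <≡ (firstAscent-cong w~w′)

longestDesSuffix-cong : ∀ {w w′} → SameAscents w w′ → longestDesSuffix w ≡ longestDesSuffix w′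
longestDesSuffix-cong []   = refl
longestDesSuffix-cong [-] = refl
longestDesSuffix-cong w~w′@(_ ∷ _) =
  cong₃ (λ f m n → if even f ∧ (1 <ᵇ f) then m else n)
    (firstAscent-cong w~w′) (SameAscents-length w~w′) (longestDesSuffix-cong (SameAscents-tail w~w′))
  where
  cong₃ : ∀ {A B C D : Set} (f : A → B → C → D) {a a′ b b′ c c′} → a ≡ a′ → b ≡ b′ → c ≡ c′ → f a b c ≡ f a′ b′ c′
  cong₃ f refl refl refl = refl

pix-cong : ∀ {w w′} → SameAscents w w′ → pix w ≡ pix w′
pix-cong w~w′ = cong₂ _∸_ (SameAscents-length w~w′) (longestDesSuffix-cong w~w′)

SameAscents-map-applyUpTo : ∀ (f f′ h : ℕ → ℕ) m →
  (∀ {i} → suc i < m → (f (h i) <ᵇ f (h (suc i))) ≡ (f′ (h i) <ᵇ f′ (h (suc i)))) →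
  SameAscents (map f (applyUpTo h m)) (map f′ (applyUpTo h m))
SameAscents-map-applyUpTo f f′ h zero          _    = []
SameAscents-map-applyUpTo f f′ h (suc zero)    _    = [-]
SameAscents-map-applyUpTo f f′ h (suc (suc m)) <≡ =
  <≡ (s≤s (s≤s z≤n)) ∷ SameAscents-map-applyUpTo f f′ (h ∘ suc) (suc m) (<≡ ∘ s≤s)

-- The ascents of π⁻¹ record, for each letter i, whether i precedes i + 1 in π.
pix-inverse-cong : ∀ {n π π′} → IsPermutation n π → IsPermutation n π′ →
  (∀ {i} → i ∈ π → suc i ∈ π → precedes i (suc i) π ≡ precedes i (suc i) π′) →
  pix (inverse π) ≡ pix (inverse π′)
pix-inverse-cong {n} {π} {π′} σ σ′ precedes≡ rewrite inverse≡map-posOf σ | inverse≡map-posOf σ′ =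
  pix-cong (SameAscents-map-applyUpTo (λ j → posOf j π) (λ j → posOf j π′) suc n (λ {i} i+1<n →
    let i+1∈ = ∈-oneTo⁺ {n} {suc i} (s≤s z≤n) (<⇒≤ i+1<n)
        i+2∈ = ∈-oneTo⁺ {n} {suc (suc i)} (s≤s z≤n) i+1<n
    in trans (posOf-<ᵇ≡precedes π (∈π σ i+1∈) (∈π σ i+2∈))
      (trans (precedes≡ (∈π σ i+1∈) (∈π σ i+2∈))
             (sym (posOf-<ᵇ≡precedes π′ (∈π σ′ i+1∈) (∈π σ′ i+2∈))))))
  where
  ∈π : ∀ {ρ j} → IsPermutation n ρ → j ∈ oneTo n → j ∈ ρ
  ∈π ρ = ∈-resp-↭ (↭-sym ρ)

module _ {n : ℕ} {π : List ℕ} (σ : IsPermutation n π) where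

  private
    I : FoataInvariant (foata π) π
    I = foata-invariant π (IsPermutation⇒Unique σ)
    open FoataInvariant I

  foata-IsPermutation : IsPermutation n (foata π)
  foata-IsPermutation = ↭-trans permutes σ

  inv-foata : inv (foata π) ≡ maj π
  inv-foata = inv≡maj

  pix-inverse-foata : pix (inverse (foata π)) ≡ pix (inverse π)
  pix-inverse-foata = pix-inverse-cong foata-IsPermutation σ
    (λ i∈ i+1∈ → precedes-suc≡ (∈-resp-↭ permutes i∈) (∈-resp-↭ permutes i+1∈))

module _ (n : ℕ) (p : List ℕ → Bool) where

  count-perms-inverse : count (p ∘ inverse) (perms n) ≡ count p (perms n)
  count-perms-inverse = count-perms-reindex n p inverse inverse-IsPermutation
    (λ σ τ eq → trans (sym (inverse-involutive σ)) (trans (cong inverse eq) (inverse-involutive τ)))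

  count-perms-foata : count (p ∘ foata) (perms n) ≡ count p (perms n)
  count-perms-foata = count-perms-reindex n p foata foata-IsPermutation
    (λ σ τ → foata-injective (trans (IsPermutation⇒length σ) (sym (IsPermutation⇒length τ))))

corollary2p9 : (n a k : ℕ) →
    count (λ σ → (pix σ ≡ᵇ a) ∧ (inv σ ≡ᵇ k)) (perms n)
      ≡ count (λ σ → (pix σ ≡ᵇ a) ∧ (imaj σ ≡ᵇ k)) (perms n)
corollary2p9 n a k = begin
  count (λ σ → (pix σ ≡ᵇ a) ∧ (inv σ ≡ᵇ k)) (perms n)
    ≡⟨ count-perms-inverse n _ ⟨
  count (λ π → (pix (inverse π) ≡ᵇ a) ∧ (inv (inverse π) ≡ᵇ k)) (perms n)
    ≡⟨ count-perms-cong n _ (λ {π} σ → cong (λ m → (pix (inverse π) ≡ᵇ a) ∧ (m ≡ᵇ k)) (inv-inverse σ)) ⟩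
  count (λ π → (pix (inverse π) ≡ᵇ a) ∧ (inv π ≡ᵇ k)) (perms n)
    ≡⟨ count-perms-foata n _ ⟨
  count (λ π → (pix (inverse (foata π)) ≡ᵇ a) ∧ (inv (foata π) ≡ᵇ k)) (perms n)
    ≡⟨ count-perms-cong n _ (λ σ → cong₂ (λ ℓ m → (ℓ ≡ᵇ a) ∧ (m ≡ᵇ k)) (pix-inverse-foata σ) (inv-foata σ)) ⟩
  count (λ π → (pix (inverse π) ≡ᵇ a) ∧ (maj π ≡ᵇ k)) (perms n)
    ≡⟨ count-perms-cong n _ (λ {π} σ → cong (λ τ → (pix (inverse π) ≡ᵇ a) ∧ (maj τ ≡ᵇ k)) (sym (inverse-involutive σ))) ⟩
  count (λ π → (pix (inverse π) ≡ᵇ a) ∧ (imaj (inverse π) ≡ᵇ k)) (perms n)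
    ≡⟨ count-perms-inverse n _ ⟩
  count (λ σ → (pix σ ≡ᵇ a) ∧ (imaj σ ≡ᵇ k)) (perms n) ∎
  where open ≡-Reasoning
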